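{- Let $n$ be a positive integer and let $F_n$ be the set of rational numbers $a/b$ with integers $0\le a\le b\le n$, $b\ge1$, $\gcd(a,b)=1$. Suppose $S\subseteq F_n$ and $\mathcal{Q}(S)=F_n$. Then $S=\{0,1,\frac12,\frac13,\ldots,\frac1n\}$ or $S=\{0,1,\frac1n,\frac2n,\ldots,\frac{n-1}{n}\}$.
   Context: For a set $S$ of real numbers, $\mathcal{Q}(S)=\{x/y : x,y\in S,\ x\le y,\ y\neq 0\}$; by convention, if $S=\{0\}$ then $\mathcal{Q}(S)=\{0\}$. -}

module Defs where

open import Data.Nat as ℕ using (ℕ; zero; suc)
open import Data.Nat.GCD using (gcd)
open import Data.Integer using (+_)
open import Data.Rational using (ℚ; 0ℚ; _/_; _÷_; _≤_; ≢-nonZero)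
open import Data.List using (List)
open import Data.List.Membership.Propositional using (_∈_)
open import Data.Product using (Σ; ∃; ∃₂; _×_)
open import Data.Sum using (_⊎_)
open import Function.Bundles using (_⇔_)
open import Relation.Binary.PropositionalEquality using (_≡_; _≢_)

-- the fraction a/b for a natural denominator b ≥ 1 (value at b = 0 is irrelevant: always guarded by 1 ≤ b)
frac : ℕ → ℕ → ℚ
frac a zero    = 0ℚ
frac a (suc b) = (+ a) / suc b

F : ℕ → ℚ → Set
F n q = ∃₂ λ a b → (1 ℕ.≤ b) × (a ℕ.≤ b) × (b ℕ.≤ n) × (gcd a b ≡ 1) × (q ≡ frac a b)

-- finite sets of rationals are represented by lists (membership = _∈_)
-- S = {0}
IsZeroSet : List ℚ → Set
IsZeroSet S = ∀ z → (z ∈ S) ⇔ (z ≡ 0ℚ)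

InQ : List ℚ → ℚ → Set
InQ S q =
  (∃₂ λ x y → (x ∈ S) × (y ∈ S) × (x ≤ y) ×
     Σ (y ≢ 0ℚ) λ y≢0 → q ≡ _÷_ x y {{≢-nonZero y≢0}})
  ⊎ (IsZeroSet S × q ≡ 0ℚ)

Harmonic : ℕ → ℚ → Set
Harmonic n q = q ≡ 0ℚ ⊎ ∃ λ k → (1 ℕ.≤ k) × (k ℕ.≤ n) × (q ≡ frac 1 k)

Uniform : ℕ → ℚ → Set
Uniform n q = q ≡ 0ℚ ⊎ q ≡ frac 1 1 ⊎ ∃ λ k → (1 ℕ.≤ k) × (k ℕ.< n) × (q ≡ frac k n)

{-# OPTIONS --safe #-}

-- All quotients of S lie in F n, so attaining 1/n forces 1/n, 1 ∈ S, and attaining 1/(n − 1)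
-- forces 1/(n − 1) ∈ S or (n − 1)/n ∈ S. The inversion s ↦ 1/(n s) exchanges these two cases.
-- In the first case every element of S above 1/2 equals 1, so attaining 1/k with k > n/2 puts
-- 1/k in S. An element a/b of S in lowest terms with a ≥ 2 would then give, for some k > n/2
-- prime to b, the quotient b/(a k) with reduced denominator a k > n. So S consists of 0 and
-- unit fractions, and attaining k/l with l > n/2 prime to k puts every 1/k in S.
module Submission where

open import Defs
open import Data.Nat using (ℕ; _≤_)
open import Data.Rational using (ℚ)
open import Data.List using (List)
open import Data.List.Membership.Propositional using (_∈_)
open import Data.Sum using (_⊎_)
open import Function.Bundles using (_⇔_)

open import Data.Nat as ℕ using (zero; suc; _+_; _*_; _/_; _%_; _<_; z≤n; s≤s; NonZero; >-nonZero; >-nonZero⁻¹)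
open import Data.Nat.Properties
open import Data.Nat.DivMod using (m≡m%n+[m/n]*n; m%n<n; m/n*n≤m; m/n*n≡m; m≥n⇒m/n>0)
open import Data.Nat.Divisibility using (_∣_; divides; ∣⇒≤; ∣-trans; ∣-refl; n∣m*n; ∣m+n∣m⇒∣n; ∣1⇒≡1; 1∣_; *-monoˡ-∣; ∣-reflexive)
open import Data.Nat.GCD using (gcd; gcd[m,n]∣m; gcd[m,n]∣n; gcd[m,n]≢0)
open import Data.Nat.Coprimality as Coprimality using (Coprime; coprime-divisor; gcd≡1⇒coprime; coprime⇒gcd≡1; coprime-/gcd)
import Data.Integer as ℤ
import Data.Integer.Properties as ℤ
open import Data.Rational as ℚ using (0ℚ)
import Data.Rational.Properties as ℚ
open import Data.Rational.Unnormalised as ℚᵘ using (mkℚᵘ)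
import Data.Rational.Unnormalised.Properties as ℚᵘ
open import Data.Nat.Tactic.RingSolver using (solve)
open import Data.List using ([]; _∷_)
open import Data.Product using (∃; ∃₂; _×_; _,_; proj₁; proj₂)
open import Data.Sum using (inj₁; inj₂)
open import Function.Bundles using (mk⇔; module Equivalence)
open import Relation.Nullary using (¬_; yes; no; contradiction)
open import Relation.Binary.PropositionalEquality using (_≡_; _≢_; refl; sym; trans; cong; subst)

open ≤-Reasoning

-- Coprimality.

1≤∧2≰⇒≡1 : ∀ {a} → NonZero a → ¬ 2 ≤ a → a ≡ 1
1≤∧2≰⇒≡1 {a} a≢0 2≰a = ≤-antisym (≤-pred (≰⇒> 2≰a)) (>-nonZero⁻¹ a {{a≢0}})

coprime-*ʳ : ∀ {b a c} → Coprime b a → Coprime b c → Coprime b (a * c)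
coprime-*ʳ b⊥a b⊥c (d∣b , d∣ac) =
  b⊥c (d∣b , coprime-divisor (λ (e∣d , e∣a) → b⊥a (∣-trans e∣d d∣b , e∣a)) d∣ac)

coprime-suc : ∀ {m} → Coprime m (suc m)
coprime-suc {m} {d} (d∣m , d∣1+m) = ∣1⇒≡1 (∣m+n∣m⇒∣n (subst (d ∣_) (+-comm 1 m) d∣1+m) d∣m)

-- The witness is k = 1 + b ⌊m/b⌋.
large-coprime : ∀ {b m} .{{_ : NonZero b}} → b ≤ m →
  ∃ λ k → Coprime b k × b < k × k ≤ suc m × suc m < 2 * k
large-coprime {b} {m} b≤m = suc (q * b) , coprime , s≤s b≤qb , s≤s (m/n*n≤m m b) , bound
  where
  q = m / b
  coprime : Coprime b (suc (q * b))
  coprime (d∣b , d∣k) = coprime-suc (∣-trans d∣b (n∣m*n q) , d∣k)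
  b≤qb : b ≤ q * b
  b≤qb = m≤n*m b q {{>-nonZero (m≥n⇒m/n>0 b≤m)}}
  -- The remainder of m is below b ≤ b ⌊m/b⌋, so m < 2 b ⌊m/b⌋.
  bound : suc m < 2 * suc (q * b)
  bound = begin-strict
    suc m                  ≡⟨ cong suc (m≡m%n+[m/n]*n m b) ⟩
    suc (m % b + q * b)    <⟨ s≤s (+-monoˡ-< (q * b) (<-≤-trans (m%n<n m b) b≤qb)) ⟩
    suc (q * b + q * b)    ≤⟨ n≤1+n _ ⟩
    2 + (q * b + q * b)    ≡⟨ double (q * b) ⟩
    2 * suc (q * b)        ∎
    where
    double : ∀ x → 2 + (x + x) ≡ 2 * suc x
    double x = solve (x ∷ [])

-- Farey fractions by cross multiplication.

-- The value of a/b lies in F n, without requiring a/b to be in lowest terms.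
InFarey : ℕ → ℕ → ℕ → Set
InFarey n a b = ∃₂ λ c d → NonZero d × c ≤ d × d ≤ n × a * d ≡ c * b

inFarey⇒≤ : ∀ {n a b} → InFarey n a b → a ≤ b
inFarey⇒≤ {n} {a} {b} (c , d , d≢0 , c≤d , d≤n , ad≡cb) = *-cancelˡ-≤ d {{d≢0}} (begin
  d * a  ≡⟨ *-comm d a ⟩
  a * d  ≡⟨ ad≡cb ⟩
  c * b  ≤⟨ *-monoˡ-≤ b c≤d ⟩
  d * b  ∎)

-- A positive value c/d has c ≥ 1 and d ≤ n, hence is at least 1/n.
inFarey⇒≥ : ∀ {n a b} → NonZero a → InFarey n a b → b ≤ n * a
inFarey⇒≥ {n} {a} {b} a≢0 (c , d , d≢0 , c≤d , d≤n , ad≡cb) = begin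
  b      ≤⟨ m≤n*m b c {{c≢0}} ⟩
  c * b  ≡⟨ ad≡cb ⟨
  a * d  ≤⟨ *-monoʳ-≤ a d≤n ⟩
  a * n  ≡⟨ *-comm a n ⟩
  n * a  ∎
  where
  c≢0 : NonZero c
  c≢0 = m*n≢0⇒m≢0 c {b} {{subst NonZero ad≡cb (m*n≢0 a d {{a≢0}} {{d≢0}})}}

-- The denominator in lowest terms divides every other denominator of the same value, in particular
-- one that is at most n.
inFarey-coprime : ∀ {n a b} → Coprime b a → InFarey n a b → b ≤ n
inFarey-coprime b⊥a (c , d , d≢0 , c≤d , d≤n , ad≡cb) =
  ≤-trans (∣⇒≤ {{d≢0}} (coprime-divisor b⊥a (divides c ad≡cb))) d≤n

-- Sets of positive fractions with Farey quotients.

-- R a b stands for: a and b are positive and a/b lies in S.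
record FareyQuotients (n : ℕ) (R : ℕ → ℕ → Set) : Set where
  field
    num≢0    : ∀ {a b} → R a b → NonZero a
    den≢0    : ∀ {a b} → R a b → NonZero b
    resp     : ∀ {a b c d} → NonZero c → NonZero d → a * d ≡ c * b → R a b → R c d
    inFarey  : ∀ {a b} → R a b → InFarey n a b
    -- Here (a/b)/(c/d) is written as (a d)/(c b); `attained` likewise encodes (x/x′)/(y/y′) = a/b.
    quotient : ∀ {a b c d} → R a b → R c d → a * d ≤ c * b → InFarey n (a * d) (c * b)
    attained : ∀ {a b} → 1 ≤ a → a ≤ b → b ≤ n → Coprime a b →
      ∃₂ λ x x′ → ∃₂ λ y y′ → R x x′ × R y y′ × (x * y′) * b ≡ a * (y * x′)

module _ {n R} (FQ : FareyQuotients n R) where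
  open FareyQuotients FQ

  den≤n*num : ∀ {a b} → R a b → b ≤ n * a
  den≤n*num r = inFarey⇒≥ (num≢0 r) (inFarey r)

  reduce : ∀ {a b} → R a b →
    ∃₂ λ a₀ b₀ → ∃ λ g → Coprime a₀ b₀ × R a₀ b₀ × NonZero g × a ≡ a₀ * g × b ≡ b₀ * g
  reduce {a} {b} r = a / g , b / g , g , coprime-/gcd a b , r₀ , g≢0 , a≡ , b≡
    where
    g = gcd a b
    instance
      g≢0 : NonZero g
      g≢0 = ℕ.≢-nonZero (gcd[m,n]≢0 a b (inj₁ (ℕ.≢-nonZero⁻¹ a {{num≢0 r}})))
    a≡ : a ≡ a / g * g
    a≡ = sym (m/n*n≡m (gcd[m,n]∣m a b))
    b≡ : b ≡ b / g * g
    b≡ = sym (m/n*n≡m (gcd[m,n]∣n a b))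
    cross : ∀ u v w → (u * w) * v ≡ u * (v * w)
    cross u v w = solve (u ∷ v ∷ w ∷ [])
    r₀ : R (a / g) (b / g)
    r₀ = resp (m*n≢0⇒m≢0 (a / g) {g} {{subst NonZero a≡ (num≢0 r)}})
              (m*n≢0⇒m≢0 (b / g) {g} {{subst NonZero b≡ (den≢0 r)}})
              (trans (cong (_* (b / g)) a≡) (trans (cross (a / g) (b / g) g) (cong (a / g *_) (sym b≡)))) r

  -- Writing 1/k = x/y, the element y is at least k/n because x is at least 1/n.
  attain-unit : ∀ {k} → 1 ≤ k → k ≤ n →
    ∃₂ λ y y′ → R y y′ × k * y′ ≤ n * y × (y ≡ y′ → R 1 k)
  attain-unit {k} 1≤k k≤n with attained ≤-refl 1≤k k≤n (λ (d∣1 , _) → ∣1⇒≡1 d∣1)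
  ... | x , x′ , y , y′ , rx , ry , eq = y , y′ , ry , bound , unit
    where
    bound : k * y′ ≤ n * y
    bound = *-cancelˡ-≤ x {{num≢0 rx}} (begin
      x * (k * y′)  ≡⟨ solve (x ∷ k ∷ y′ ∷ []) ⟩
      x * y′ * k    ≡⟨ eq ⟩
      1 * (y * x′)  ≡⟨ *-identityˡ (y * x′) ⟩
      y * x′        ≤⟨ *-monoʳ-≤ y (den≤n*num rx) ⟩
      y * (n * x)   ≡⟨ solve (x ∷ n ∷ y ∷ []) ⟩
      x * (n * y)   ∎)
    unit : y ≡ y′ → R 1 k
    unit refl = resp _ (>-nonZero 1≤k) (*-cancelˡ-≡ (x * k) (1 * x′) y {{num≢0 ry}} (begin-equality
      y * (x * k)   ≡⟨ solve (x ∷ k ∷ y ∷ []) ⟩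
      x * y * k     ≡⟨ eq ⟩
      1 * (y * x′)  ≡⟨ solve (x′ ∷ y ∷ []) ⟩
      y * (1 * x′)  ∎)) rx

  -- For k = n the bound in `attain-unit` makes the divisor at least 1. So the divisor is 1 and the
  -- dividend is 1/n.
  unit-n : 1 ≤ n → R 1 n × R 1 1
  unit-n 1≤n with attain-unit 1≤n ≤-refl
  ... | y , y′ , ry , bound , unit with ≤-antisym (inFarey⇒≤ (inFarey ry)) (*-cancelˡ-≤ n {{>-nonZero 1≤n}} bound)
  ... | refl = unit refl , resp _ _ (*-comm y 1) ry

-- Inversion and the two cases.

-- The inversion s ↦ 1/(n s), which exchanges the two extremal sets.
dual : ∀ {n R} → 1 ≤ n → FareyQuotients n R → FareyQuotients n (λ a b → R b (n * a))
dual {n} {R} 1≤n FQ = record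
  { num≢0 = λ {a} r → m*n≢0⇒n≢0 n {a} {{den≢0 r}}
  ; den≢0 = num≢0
  ; resp = λ {a} {b} {c} {d} c≢0 d≢0 eq →
      resp d≢0 (m*n≢0 n c {{n≢0}} {{c≢0}}) (resp-eq a b c d eq)
  -- The quotient of 1/n by b/(n a) is a/b.
  ; inFarey = λ {a} {b} r → cancel-inFarey a b (quotient (proj₁ (unit-n FQ 1≤n)) r (1*na≤bn a b r))
  -- Inversion reverses the order, so dividend and divisor trade places and the quotient is
  -- unchanged.
  ; quotient = λ {a} {b} {c} {d} r r′ ad≤cb →
      cancel-quotient a b c d (quotient r′ r (quotient-≤ a b c d ad≤cb))
  ; attained = λ {a} {b} 1≤a a≤b b≤n a⊥b → dual-attained a b (attained 1≤a a≤b b≤n a⊥b)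
  }
  where
  open FareyQuotients FQ
  n≢0 : NonZero n
  n≢0 = >-nonZero 1≤n
  resp-eq : ∀ a b c d → a * d ≡ c * b → b * (n * c) ≡ d * (n * a)
  resp-eq a b c d eq = begin-equality
    b * (n * c)  ≡⟨ solve (b ∷ n ∷ c ∷ []) ⟩
    n * (c * b)  ≡⟨ cong (n *_) eq ⟨
    n * (a * d)  ≡⟨ solve (n ∷ a ∷ d ∷ []) ⟩
    d * (n * a)  ∎
  1*na≤bn : ∀ a b → R b (n * a) → 1 * (n * a) ≤ b * n
  1*na≤bn a b r = begin
    1 * (n * a)  ≡⟨ *-identityˡ (n * a) ⟩
    n * a        ≤⟨ den≤n*num FQ r ⟩
    n * b        ≡⟨ *-comm n b ⟩
    b * n        ∎
  cancel-inFarey : ∀ a b → InFarey n (1 * (n * a)) (b * n) → InFarey n a b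
  cancel-inFarey a b (c , d , d≢0 , c≤d , d≤n , eq) =
    c , d , d≢0 , c≤d , d≤n , *-cancelˡ-≡ (a * d) (c * b) n {{n≢0}} (begin-equality
      n * (a * d)        ≡⟨ solve (n ∷ a ∷ d ∷ []) ⟩
      1 * (n * a) * d    ≡⟨ eq ⟩
      c * (b * n)        ≡⟨ solve (n ∷ b ∷ c ∷ []) ⟩
      n * (c * b)        ∎)
  quotient-≤ : ∀ a b c d → a * d ≤ c * b → d * (n * a) ≤ b * (n * c)
  quotient-≤ a b c d le = begin
    d * (n * a)  ≡⟨ solve (d ∷ n ∷ a ∷ []) ⟩
    n * (a * d)  ≤⟨ *-monoʳ-≤ n le ⟩
    n * (c * b)  ≡⟨ solve (b ∷ n ∷ c ∷ []) ⟩
    b * (n * c)  ∎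
  cancel-quotient : ∀ a b c d → InFarey n (d * (n * a)) (b * (n * c)) → InFarey n (a * d) (c * b)
  cancel-quotient a b c d (e , f , f≢0 , e≤f , f≤n , eq) =
    e , f , f≢0 , e≤f , f≤n , *-cancelˡ-≡ (a * d * f) (e * (c * b)) n {{n≢0}} (begin-equality
      n * (a * d * f)    ≡⟨ solve (n ∷ a ∷ d ∷ f ∷ []) ⟩
      d * (n * a) * f    ≡⟨ eq ⟩
      e * (b * (n * c))  ≡⟨ solve (n ∷ b ∷ c ∷ e ∷ []) ⟩
      n * (e * (c * b))  ∎)
  dual-attained : ∀ a b →
    (∃₂ λ x x′ → ∃₂ λ y y′ → R x x′ × R y y′ × (x * y′) * b ≡ a * (y * x′)) →
    ∃₂ λ x x′ → ∃₂ λ y y′ → R x′ (n * x) × R y′ (n * y) × (x * y′) * b ≡ a * (y * x′)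
  dual-attained a b (x , x′ , y , y′ , rx , ry , eq) =
    y′ , n * y , x′ , n * x , scale ry , scale rx , (begin-equality
      y′ * (n * x) * b    ≡⟨ solve (n ∷ y′ ∷ x ∷ b ∷ []) ⟩
      n * (x * y′ * b)    ≡⟨ cong (n *_) eq ⟩
      n * (a * (y * x′))  ≡⟨ solve (n ∷ a ∷ y ∷ x′ ∷ []) ⟩
      a * (x′ * (n * y))  ∎)
    where
    scale : ∀ {u u′} → R u u′ → R (n * u) (n * u′)
    scale {u} {u′} r = resp {u} {u′} (m*n≢0 n u {{n≢0}} {{num≢0 r}}) (m*n≢0 n u′ {{n≢0}} {{den≢0 r}})
      (solve (n ∷ u ∷ u′ ∷ [])) r

-- The divisor y in 1/m = x/y is at least m/(m + 1) and is a value of F (m + 1). The only values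
-- that large are m/(m + 1) and 1, and y = 1 means x = 1/m.
dichotomy : ∀ {m R} → 1 ≤ m → FareyQuotients (suc m) R → R 1 m ⊎ R m (suc m)
dichotomy {m} {R} 1≤m FQ with attain-unit FQ 1≤m (n≤1+n m)
... | y , y′ , ry , bound , unit with inFarey ry
  where open FareyQuotients FQ
... | c , d , d≢0 , c≤d , d≤n , eq with m≤n⇒m<n∨m≡n c≤d
... | inj₂ refl = inj₁ (unit (*-cancelʳ-≡ y y′ d {{d≢0}} (trans eq (*-comm d y′))))
... | inj₁ c<d = inj₂ (resp (>-nonZero 1≤m) _ (trans (*-comm y (suc m)) (≤-antisym upper bound)) ry)
  where
  open FareyQuotients FQ
  -- From c ≤ m and c + 1 ≤ d: c/d ≤ c/(c + 1) ≤ m/(m + 1).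
  nc≤dm : suc m * c ≤ d * m
  nc≤dm = begin
    c + m * c    ≤⟨ +-monoˡ-≤ (m * c) (≤-pred (≤-trans c<d d≤n)) ⟩
    m + m * c    ≡⟨ *-suc m c ⟨
    m * suc c    ≤⟨ *-monoʳ-≤ m c<d ⟩
    m * d        ≡⟨ *-comm m d ⟩
    d * m        ∎
  upper : suc m * y ≤ m * y′
  upper = *-cancelˡ-≤ d {{d≢0}} (begin
    d * (suc m * y)    ≡⟨ solve (d ∷ m ∷ y ∷ []) ⟩
    suc m * (y * d)    ≡⟨ cong (suc m *_) eq ⟩
    suc m * (c * y′)   ≡⟨ *-assoc (suc m) c y′ ⟨
    suc m * c * y′     ≤⟨ *-monoˡ-≤ y′ nc≤dm ⟩
    d * m * y′         ≡⟨ *-assoc d m y′ ⟩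
    d * (m * y′)       ∎)

-- The case of 1/(n - 1) in S.

module Harmonic-case {m R} (1≤m : 1 ≤ m) (FQ : FareyQuotients (suc m) R) (1/m : R 1 m) where
  open FareyQuotients FQ

  n = suc m

  1/n : R 1 n
  1/n = proj₁ (unit-n FQ (s≤s z≤n))

  n≤2m : n ≤ 2 * m
  n≤2m = begin
    1 + m        ≤⟨ +-monoˡ-≤ m 1≤m ⟩
    m + m        ≡⟨ cong (m +_) (+-identityʳ m) ⟨
    m + (m + 0)  ∎

  -- The quotient (1/k)/(a/b) = b/(a k) is admissible because b ≤ n ≤ 2 k ≤ a k. It is in lowest
  -- terms, so its denominator is at most n.
  a*k≤n : ∀ {a b k} → R 1 k → R a b → Coprime a b → Coprime b k → n ≤ 2 * k → 2 ≤ a → a * k ≤ n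
  a*k≤n {a} {b} {k} 1/k r a⊥b b⊥k n≤2k 2≤a =
    inFarey-coprime
      (coprime-*ʳ (λ (_ , d∣1) → ∣1⇒≡1 d∣1) (Coprimality.sym (coprime-*ʳ (Coprimality.sym a⊥b) b⊥k)))
      (quotient 1/k r (begin
        1 * b  ≡⟨ *-identityˡ b ⟩
        b      ≤⟨ inFarey-coprime (Coprimality.sym a⊥b) (inFarey r) ⟩
        n      ≤⟨ n≤2k ⟩
        2 * k  ≤⟨ *-monoˡ-≤ k 2≤a ⟩
        a * k  ∎))

  -- If a ≥ 2, then `a*k≤n` with k = m gives 2 m ≤ m + 1, which leaves only n = 2. There b ≤ 2 ≤ a ≤
  -- b, so a = b, and lowest terms force a = 1.
  num≡1-coprime-m : ∀ {a b} → R a b → Coprime a b → Coprime b m → a ≡ 1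
  num≡1-coprime-m {a} {b} r a⊥b b⊥m with 2 ≤? a
  ... | no 2≰a = 1≤∧2≰⇒≡1 (num≢0 r) 2≰a
  ... | yes 2≤a = a⊥b (∣-refl , ∣-reflexive a≡b)
    where
    m≤1 : m ≤ 1
    m≤1 = +-cancelʳ-≤ m m 1 (begin
      m + m        ≡⟨ cong (m +_) (+-identityʳ m) ⟨
      2 * m        ≤⟨ *-monoˡ-≤ m 2≤a ⟩
      a * m        ≤⟨ a*k≤n 1/m r a⊥b b⊥m n≤2m 2≤a ⟩
      1 + m        ∎)
    a≡b : a ≡ b
    a≡b = ≤-antisym (inFarey⇒≤ (inFarey r))
      (≤-trans (inFarey-coprime (Coprimality.sym a⊥b) (inFarey r)) (≤-trans (s≤s m≤1) 2≤a))

  -- Comparing a/b > 1/2 with 1/n forces b ∣ n when a ≥ 2, so b is prime to n − 1.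
  num≡1-large : ∀ {a b} → R a b → Coprime a b → b < 2 * a → a ≡ 1
  num≡1-large {a} {b} r a⊥b b<2a
    with quotient 1/n r (≤-trans (≤-reflexive (*-identityˡ b)) (≤-trans (den≤n*num FQ r) (≤-reflexive (*-comm n a))))
  ... | c , d , d≢0 , c≤d , d≤n , eq = num≡1-coprime-m r a⊥b b⊥m
    where
    bd≡cna : b * d ≡ c * n * a
    bd≡cna = begin-equality
      b * d        ≡⟨ cong (_* d) (*-identityˡ b) ⟨
      1 * b * d    ≡⟨ eq ⟩
      c * (a * n)  ≡⟨ cong (c *_) (*-comm a n) ⟩
      c * (n * a)  ≡⟨ *-assoc c n a ⟨
      c * n * a    ∎
    -- Since c/d = b/(a n) with d ≤ n, one has c a ≤ b < 2 a, which leaves c = 1.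
    ca≤b : c * a ≤ b
    ca≤b = *-cancelʳ-≤ (c * a) b n (begin
      c * a * n    ≡⟨ *-assoc c a n ⟩
      c * (a * n)  ≡⟨ eq ⟨
      1 * b * d    ≡⟨ cong (_* d) (*-identityˡ b) ⟩
      b * d        ≤⟨ *-monoʳ-≤ b d≤n ⟩
      b * n        ∎)
    c≢0 : NonZero c
    c≢0 = m*n≢0⇒m≢0 c {n} {{m*n≢0⇒m≢0 (c * n) {a} {{subst NonZero bd≡cna (m*n≢0 b d {{den≢0 r}} {{d≢0}})}}}}
    c≡1 : c ≡ 1
    c≡1 = 1≤∧2≰⇒≡1 c≢0 (<⇒≱ (*-cancelʳ-< a c 2 (≤-<-trans ca≤b b<2a)))
    -- As a is prime to b, it divides d, say d = e a; then b d = n a gives n = e b.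
    b∣n : b ∣ n
    b∣n with coprime-divisor a⊥b (divides (c * n) bd≡cna)
    ... | divides e refl = divides e (*-cancelʳ-≡ n (e * b) a {{num≢0 r}} (begin-equality
      n * a        ≡⟨ cong (_* a) (*-identityˡ n) ⟨
      1 * n * a    ≡⟨ cong (λ c → c * n * a) c≡1 ⟨
      c * n * a    ≡⟨ bd≡cna ⟨
      b * (e * a)  ≡⟨ *-assoc b e a ⟨
      b * e * a    ≡⟨ cong (_* a) (*-comm b e) ⟩
      e * b * a    ∎))
    b⊥m : Coprime b m
    b⊥m (e∣b , e∣m) = coprime-suc (e∣m , ∣-trans e∣b b∣n)

  -- The divisor in 1/k = x/y is at least k/n > 1/2. In lowest terms its numerator is 1, hence its
  -- denominator is 1 too, and the dividend is 1/k itself.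
  unit-large : ∀ {k} → 1 ≤ k → k ≤ n → n < 2 * k → R 1 k
  unit-large {k} 1≤k k≤n n<2k with attain-unit FQ 1≤k k≤n
  ... | y , y′ , ry , bound , unit with reduce FQ ry
  ... | y₀ , y₀′ , g , y₀⊥y₀′ , ry₀ , g≢0 , refl , refl =
    unit (cong (_* g) (trans y₀≡1 (sym y₀′≡1)))
    where
    y<2y₀ : y₀′ < 2 * y₀
    y<2y₀ = *-cancelʳ-< g y₀′ (2 * y₀) (*-cancelˡ-< k (y₀′ * g) (2 * y₀ * g) (begin-strict
      k * (y₀′ * g)    ≤⟨ bound ⟩
      n * (y₀ * g)     <⟨ *-monoˡ-< (y₀ * g) {{num≢0 ry}} n<2k ⟩
      2 * k * (y₀ * g) ≡⟨ solve (k ∷ y₀ ∷ g ∷ []) ⟩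
      k * (2 * y₀ * g) ∎))
    y₀≡1 : y₀ ≡ 1
    y₀≡1 = num≡1-large ry₀ y₀⊥y₀′ y<2y₀
    y₀′≡1 : y₀′ ≡ 1
    y₀′≡1 = 1≤∧2≰⇒≡1 (den≢0 ry₀) (<⇒≱ (subst (λ z → y₀′ < 2 * z) y₀≡1 y<2y₀))

  -- For b < n, `large-coprime` supplies k > n/2 prime to b, and a ≥ 2 would give 2 k ≤ a k ≤ n < 2
  -- k. For b = n, the number m = n - 1 is already prime to b.
  num≡1 : ∀ {a b} → R a b → Coprime a b → a ≡ 1
  num≡1 {a} {b} r a⊥b with 2 ≤? a | m≤n⇒m<n∨m≡n (inFarey-coprime (Coprimality.sym a⊥b) (inFarey r))
  ... | no 2≰a  | _ = 1≤∧2≰⇒≡1 (num≢0 r) 2≰a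
  ... | yes _   | inj₂ refl = num≡1-coprime-m r a⊥b (Coprimality.sym coprime-suc)
  ... | yes 2≤a | inj₁ b<n with large-coprime {{den≢0 r}} (≤-pred b<n)
  ... | k , b⊥k , b<k , k≤n , n<2k =
    contradiction (≤-trans (*-monoˡ-≤ k 2≤a) (a*k≤n (unit-large (≤-trans (s≤s z≤n) b<k) k≤n n<2k) r a⊥b b⊥k (<⇒≤ n<2k) 2≤a)) (<⇒≱ n<2k)

  num∣den : ∀ {a b} → R a b → a ∣ b
  num∣den r with reduce FQ r
  ... | a₀ , b₀ , g , a₀⊥b₀ , r₀ , g≢0 , refl , refl =
    *-monoˡ-∣ g (subst (_∣ b₀) (sym (num≡1 r₀ a₀⊥b₀)) (1∣ b₀))

  -- Choosing l > n/2 prime to k, the fraction k/l can only be attained as (1/l)/(1/k).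
  unit : ∀ {k} → 1 ≤ k → k ≤ n → R 1 k
  unit {k} 1≤k k≤n with m≤n⇒m<n∨m≡n k≤n
  ... | inj₂ refl = 1/n
  ... | inj₁ k<n with large-coprime {{>-nonZero 1≤k}} (≤-pred k<n)
  ... | l , k⊥l , k<l , l≤n , n<2l with attained 1≤k (<⇒≤ k<l) l≤n k⊥l
  ... | x , x′ , y , y′ , rx , ry , eq with num∣den rx | num∣den ry
  -- With dividend 1/x₁ and divisor 1/y₁, attaining k/l reads l y₁ = x₁ k, so k divides y₁.
  ... | divides x₁ refl | divides y₁ refl with coprime-divisor {o = y₁} k⊥l (divides x₁ ly₁≡x₁k)
    where
    ly₁≡x₁k : l * y₁ ≡ x₁ * k
    ly₁≡x₁k = *-cancelˡ-≡ (l * y₁) (x₁ * k) (x * y) {{m*n≢0 x y {{num≢0 rx}} {{num≢0 ry}}}} (begin-equality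
      x * y * (l * y₁)    ≡⟨ solve (x ∷ y ∷ l ∷ y₁ ∷ []) ⟩
      x * (y₁ * y) * l    ≡⟨ eq ⟩
      k * (y * (x₁ * x))  ≡⟨ solve (x ∷ y ∷ k ∷ x₁ ∷ []) ⟩
      x * y * (x₁ * k)    ∎)
  ... | divides j refl = resp _ (>-nonZero 1≤k) (begin-equality
      y * k            ≡⟨ solve (y ∷ k ∷ []) ⟩
      1 * (1 * k * y)  ≡⟨ cong (λ j → 1 * (j * k * y)) j≡1 ⟨
      1 * (j * k * y)  ∎) ry
    where
    -- Now y₁ = j k and x₁ = j l. The dividend 1/(j l) is at least 1/n, so j l ≤ n < 2 l and j = 1.
    jlx≤nx : j * l * x ≤ n * x
    jlx≤nx = *-cancelʳ-≤ (j * l * x) (n * x) (k * y) {{m*n≢0 k y {{>-nonZero 1≤k}} {{num≢0 ry}}}} (begin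
      j * l * x * (k * y)    ≡⟨ solve (j ∷ l ∷ x ∷ k ∷ y ∷ []) ⟩
      x * (j * k * y) * l    ≡⟨ eq ⟩
      k * (y * (x₁ * x))     ≡⟨ solve (k ∷ y ∷ x₁ ∷ x ∷ []) ⟩
      x₁ * x * (k * y)       ≤⟨ *-monoˡ-≤ (k * y) (den≤n*num FQ rx) ⟩
      n * x * (k * y)        ∎)
    j<2 : j < 2
    j<2 = *-cancelʳ-< l j 2 (≤-<-trans (*-cancelʳ-≤ (j * l) n x {{num≢0 rx}} jlx≤nx) n<2l)
    j≢0 : NonZero j
    j≢0 = m*n≢0⇒m≢0 j {k} {{m*n≢0⇒m≢0 (j * k) {y} {{den≢0 ry}}}}
    j≡1 : j ≡ 1
    j≡1 = 1≤∧2≰⇒≡1 j≢0 (<⇒≱ j<2)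

-- The condition a ∣ b says that a/b is a unit fraction, whether or not it is in lowest terms.
IsHarmonic : ℕ → (ℕ → ℕ → Set) → Set
IsHarmonic n R = (∀ {k} → 1 ≤ k → k ≤ n → R 1 k) × (∀ {a b} → R a b → a ∣ b)

-- If (n - 1)/n is in S, its inverse image is 1/(n - 1), so the harmonic case applies to the dual
-- relation. For n = 1 the bounds a ≤ b ≤ n a leave only the value 1.
harmonic-or-dual : ∀ {n R} → 1 ≤ n → FareyQuotients n R →
  IsHarmonic n R ⊎ IsHarmonic n (λ a b → R b (n * a))
harmonic-or-dual {1} {R} 1≤n FQ = inj₁
  ( (λ 1≤k k≤1 → subst (R 1) (≤-antisym 1≤k k≤1) (proj₁ (unit-n FQ 1≤n)))
  , (λ {a} {b} r → ∣-reflexive (≤-antisym (inFarey⇒≤ (inFarey r)) (subst (b ≤_) (*-identityˡ a) (den≤n*num FQ r)))))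
  where open FareyQuotients FQ
harmonic-or-dual {suc m@(suc _)} {R} 1≤n FQ with dichotomy (s≤s z≤n) FQ
... | inj₁ 1/m = inj₁ (unit , num∣den)
  where open Harmonic-case (s≤s z≤n) FQ 1/m
... | inj₂ m/n = inj₂ (unit , num∣den)
  where open Harmonic-case (s≤s z≤n) (dual 1≤n FQ) (subst (R m) (sym (*-identityʳ (suc m))) m/n)

-- Rational numbers by cross multiplication.

frac-≡⁻ : ∀ {a b c d} .{{_ : NonZero b}} .{{_ : NonZero d}} → frac a b ≡ frac c d → a * d ≡ c * b
frac-≡⁻ {a} {b@(suc b-1)} {c} {d@(suc d-1)} eq
  with ℚ.fromℚᵘ-injective {mkℚᵘ (ℤ.+ a) b-1} {mkℚᵘ (ℤ.+ c) d-1} eq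
... | ℚᵘ.*≡* eq′ = ℤ.+-injective (trans (ℤ.pos-* a d) (trans eq′ (sym (ℤ.pos-* c b))))

frac-≡⁺ : ∀ {a b c d} .{{_ : NonZero b}} .{{_ : NonZero d}} → a * d ≡ c * b → frac a b ≡ frac c d
frac-≡⁺ {a} {b@(suc b-1)} {c} {d@(suc d-1)} eq = ℚ.fromℚᵘ-cong {mkℚᵘ (ℤ.+ a) b-1} {mkℚᵘ (ℤ.+ c) d-1}
  (ℚᵘ.*≡* (trans (sym (ℤ.pos-* a d)) (trans (cong ℤ.+_ eq) (ℤ.pos-* c b))))

frac-≤⁺ : ∀ {a b c d} .{{_ : NonZero b}} .{{_ : NonZero d}} → a * d ≤ c * b → frac a b ℚ.≤ frac c d
frac-≤⁺ {a} {b@(suc b-1)} {c} {d@(suc d-1)} le = ℚ.toℚᵘ-cancel-≤ (ℚᵘ.≤-trans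
  (ℚᵘ.≤-reflexive (ℚ.toℚᵘ-fromℚᵘ (mkℚᵘ (ℤ.+ a) b-1))) (ℚᵘ.≤-trans
  (ℚᵘ.*≤* (subst (ℤ._≤ _) (ℤ.pos-* a d) (subst (_ ℤ.≤_) (ℤ.pos-* c b) (ℤ.+≤+ le))))
  (ℚᵘ.≤-reflexive (ℚᵘ.≃-sym (ℚ.toℚᵘ-fromℚᵘ (mkℚᵘ (ℤ.+ c) d-1))))))

frac-* : ∀ a b c d .{{_ : NonZero b}} .{{_ : NonZero d}} → frac a b ℚ.* frac c d ≡ frac (a * c) (b * d)
frac-* a b@(suc b-1) c d@(suc d-1) = ℚ.toℚᵘ-injective (ℚᵘ.≃-trans
  (ℚ.toℚᵘ-homo-* (frac a b) (frac c d)) (ℚᵘ.≃-trans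
  (ℚᵘ.*-cong (ℚ.toℚᵘ-fromℚᵘ (mkℚᵘ (ℤ.+ a) b-1)) (ℚ.toℚᵘ-fromℚᵘ (mkℚᵘ (ℤ.+ c) d-1))) (ℚᵘ.≃-trans
  (ℚᵘ.*≡* (cong (ℤ._* ℤ.+ (b * d)) (sym (ℤ.pos-* a c))))
  -- `mkℚᵘ` takes the predecessor of the denominator, and `b * d` computes to `suc (d-1 + b-1 * d)`.
  (ℚᵘ.≃-sym (ℚ.toℚᵘ-fromℚᵘ (mkℚᵘ (ℤ.+ (a * c)) (d-1 + b-1 * d)))))))

÷≡⇒≡* : ∀ {p q r} .{{_ : ℚ.NonZero q}} → r ≡ p ℚ.÷ q → p ≡ r ℚ.* q
÷≡⇒≡* {p} {q} refl = sym (trans (ℚ.*-assoc p (ℚ.1/ q) q)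
  (trans (cong (p ℚ.*_) (ℚ.*-inverseˡ q)) (ℚ.*-identityʳ p)))

frac-zero : ∀ b → frac 0 b ≡ 0ℚ
frac-zero zero    = refl
frac-zero (suc b) = frac-≡⁺ {0} {suc b} {0} {1} refl

frac≢0 : ∀ {a b} → NonZero a → NonZero b → frac a b ≢ 0ℚ
frac≢0 {a} {b} a≢0 b≢0 eq = ℕ.≢-nonZero⁻¹ a {{a≢0}}
  (trans (sym (*-identityʳ a)) (frac-≡⁻ {a} {b} {0} {1} {{b≢0}} eq))

-- Passage between S and its positive fractions.

module _ {n} (1≤n : 1 ≤ n) (S : List ℚ)
  (S⊆F : ∀ q → q ∈ S → F n q) (QS⇔F : ∀ q → InQ S q ⇔ F n q) where

  -- Zero is kept apart because inversion needs positive fractions; `NonZero b` excludes the default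
  -- value of `frac a 0`.
  PositiveIn : ℕ → ℕ → Set
  PositiveIn a b = NonZero a × NonZero b × frac a b ∈ S

  -- The value 0 = 0/1 of F n is attained: either as x/y, so that x = 0, or by the convention for S
  -- = {0}.
  0∈S : 0ℚ ∈ S
  0∈S with Equivalence.from (QS⇔F 0ℚ) (0 , 1 , ≤-refl , z≤n , 1≤n , refl , refl)
  ... | inj₂ (zeroSet , _) = Equivalence.from (zeroSet 0ℚ) refl
  ... | inj₁ (x , y , x∈S , y∈S , _ , y≢0 , eq) =
    subst (_∈ S) (trans (÷≡⇒≡* {{ℚ.≢-nonZero y≢0}} eq) (ℚ.*-zeroˡ y)) x∈S

  inFarey : ∀ {a b} → NonZero b → F n (frac a b) → InFarey n a b
  inFarey {a} {b} b≢0 (c , d , 1≤d , c≤d , d≤n , _ , eq) =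
    c , d , >-nonZero 1≤d , c≤d , d≤n , frac-≡⁻ {a} {b} {c} {d} {{b≢0}} {{>-nonZero 1≤d}} eq

  quotient : ∀ {a b c d} → PositiveIn a b → PositiveIn c d → a * d ≤ c * b → InFarey n (a * d) (c * b)
  quotient {a} {b} {c} {d} (a≢0 , b≢0 , x∈S) (c≢0 , d≢0 , y∈S) ad≤cb
    with Equivalence.to (QS⇔F _) (inj₁ (frac a b , frac c d , x∈S , y∈S ,
           frac-≤⁺ {a} {b} {c} {d} {{b≢0}} {{d≢0}} ad≤cb , frac≢0 c≢0 d≢0 , refl))
  ... | e , f , 1≤f , e≤f , f≤n , _ , eq = e , f , f≢0 , e≤f , f≤n , (begin-equality
      a * d * f      ≡⟨ solve (a ∷ d ∷ f ∷ []) ⟩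
      a * (f * d)    ≡⟨ frac-≡⁻ {a} {b} {e * c} {f * d} {{b≢0}} {{m*n≢0 f d {{f≢0}} {{d≢0}}}}
                          (trans (÷≡⇒≡* {{ℚ.≢-nonZero (frac≢0 c≢0 d≢0)}} (sym eq)) (frac-* e f c d {{f≢0}} {{d≢0}})) ⟩
      e * c * b      ≡⟨ *-assoc e c b ⟩
      e * (c * b)    ∎)
    where
    f≢0 : NonZero f
    f≢0 = >-nonZero 1≤f

  attained : ∀ {a b} → 1 ≤ a → a ≤ b → b ≤ n → Coprime a b →
    ∃₂ λ x x′ → ∃₂ λ y y′ → PositiveIn x x′ × PositiveIn y y′ × (x * y′) * b ≡ a * (y * x′)
  attained {a} {b} 1≤a a≤b b≤n a⊥b
    with Equivalence.from (QS⇔F (frac a b)) (a , b , ≤-trans 1≤a a≤b , a≤b , b≤n , coprime⇒gcd≡1 a⊥b , refl)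
  -- The convention for S = {0} attains only 0, whereas a/b is positive.
  ... | inj₂ (_ , eq) = contradiction eq (frac≢0 (>-nonZero 1≤a) (>-nonZero (≤-trans 1≤a a≤b)))
  ... | inj₁ (x , y , x∈S , y∈S , _ , y≢0 , eq) with S⊆F x x∈S | S⊆F y y∈S
  ... | c , d , 1≤d , _ , _ , _ , refl | zero , f , _ , _ , _ , _ , refl = contradiction (frac-zero f) y≢0
  ... | c , d , 1≤d , _ , _ , _ , refl | e@(suc _) , f , 1≤f , _ , _ , _ , refl =
    c , d , e , f , (c≢0 , d≢0 , x∈S) , (_ , f≢0 , y∈S) , (begin-equality
      c * f * b    ≡⟨ solve (c ∷ f ∷ b ∷ []) ⟩
      c * (b * f)  ≡⟨ cross ⟩
      a * e * d    ≡⟨ *-assoc a e d ⟩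
      a * (e * d)  ∎)
    where
    b≢0 : NonZero b
    b≢0 = >-nonZero (≤-trans 1≤a a≤b)
    d≢0 : NonZero d
    d≢0 = >-nonZero 1≤d
    f≢0 : NonZero f
    f≢0 = >-nonZero 1≤f
    cross : c * (b * f) ≡ a * e * d
    cross = frac-≡⁻ {c} {d} {a * e} {b * f} {{d≢0}} {{m*n≢0 b f {{b≢0}} {{f≢0}}}}
      (trans (÷≡⇒≡* {{ℚ.≢-nonZero y≢0}} eq) (frac-* a b e f {{b≢0}} {{f≢0}}))
    c≢0 : NonZero c
    c≢0 = m*n≢0⇒m≢0 c {b * f} {{subst NonZero (sym cross)
      (m*n≢0 (a * e) d {{m*n≢0 a e {{>-nonZero 1≤a}}}} {{d≢0}})}}

  fareyQuotients : FareyQuotients n PositiveIn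
  fareyQuotients = record
    { num≢0    = proj₁
    ; den≢0    = λ (_ , b≢0 , _) → b≢0
    ; resp     = λ {a} {b} {c} {d} c≢0 d≢0 eq (_ , b≢0 , x∈S) →
        c≢0 , d≢0 , subst (_∈ S) (frac-≡⁺ {a} {b} {c} {d} {{b≢0}} {{d≢0}} eq) x∈S
    ; inFarey  = λ (_ , b≢0 , x∈S) → inFarey b≢0 (S⊆F _ x∈S)
    ; quotient = quotient
    ; attained = attained
    }

  harmonic : IsHarmonic n PositiveIn → ∀ q → (q ∈ S) ⇔ Harmonic n q
  harmonic (unit , num∣den) q = mk⇔ to from
    where
    to : q ∈ S → Harmonic n q
    to q∈S with S⊆F q q∈S
    ... | zero , b , _ , _ , _ , _ , refl = inj₁ (frac-zero b)
    ... | a@(suc _) , b , 1≤b , _ , b≤n , gcd≡1 , refl = inj₂ (b , 1≤b , b≤n , cong (λ a → frac a b) a≡1)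
      where
      a≡1 : a ≡ 1
      a≡1 = gcd≡1⇒coprime gcd≡1 (∣-refl , num∣den (_ , >-nonZero 1≤b , q∈S))
    from : Harmonic n q → q ∈ S
    from (inj₁ refl) = 0∈S
    from (inj₂ (k , 1≤k , k≤n , refl)) = proj₂ (proj₂ (unit 1≤k k≤n))

  -- Inversion sends a/b to b/(n a), a unit fraction, so b ∣ n a. In lowest terms this gives b ∣ n,
  -- and a/b can be written over n.
  uniform : IsHarmonic n (λ a b → PositiveIn b (n * a)) → ∀ q → (q ∈ S) ⇔ Uniform n q
  uniform (unit , num∣den) q = mk⇔ to from
    where
    n≢0 : NonZero n
    n≢0 = >-nonZero 1≤n
    scale : ∀ c a b → a * (c * b) ≡ c * a * b
    scale c a b = solve (c ∷ a ∷ b ∷ [])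
    to : q ∈ S → Uniform n q
    to q∈S with S⊆F q q∈S
    ... | zero , b , _ , _ , _ , _ , refl = inj₁ (frac-zero b)
    ... | a@(suc _) , b , 1≤b , a≤b , b≤n , gcd≡1 , refl
      with coprime-divisor {o = n} (Coprimality.sym (gcd≡1⇒coprime gcd≡1)) b∣an
      where
      b≢0 : NonZero b
      b≢0 = >-nonZero 1≤b
      b∣an : b ∣ a * n
      -- Expanding a/b to (n a)/(n b) gives its denominator the shape that the dual relation
      -- requires.
      b∣an = subst (b ∣_) (*-comm n a) (num∣den (resp
        (m*n≢0 n a {{n≢0}}) (m*n≢0 n b {{n≢0}} {{b≢0}}) (scale n a b) (_ , b≢0 , q∈S)))
        where
        open FareyQuotients fareyQuotients using (resp)
    ... | divides e refl with m≤n⇒m<n∨m≡n (*-monoʳ-≤ e a≤b)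
    ... | inj₁ ea<n = inj₂ (inj₂ (e * a , >-nonZero⁻¹ (e * a) {{m*n≢0 e a {{m*n≢0⇒m≢0 e {b} {{n≢0}}}}}} , ea<n ,
      frac-≡⁺ {a} {b} {e * a} {e * b} {{>-nonZero 1≤b}} {{n≢0}} (scale e a b)))
    ... | inj₂ ea≡eb = inj₂ (inj₁ (frac-≡⁺ {a} {b} {1} {1} {{>-nonZero 1≤b}} (trans (*-identityʳ a)
      (trans (*-cancelˡ-≡ a b e {{m*n≢0⇒m≢0 e {b} {{n≢0}}}} ea≡eb) (sym (*-identityˡ b))))))
    from : Uniform n q → q ∈ S
    from (inj₁ refl) = 0∈S
    from (inj₂ (inj₁ refl)) = proj₂ (proj₂ (proj₂ (unit-n fareyQuotients 1≤n)))
    -- The fraction 1/k of the dual relation is k/(n · 1) in S.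
    from (inj₂ (inj₂ (k , 1≤k , k<n , refl))) =
      subst (λ n → frac k n ∈ S) (*-identityʳ n) (proj₂ (proj₂ (unit 1≤k (<⇒≤ k<n))))

theorem3 : (n : ℕ) → 1 ≤ n → (S : List ℚ) →
    (∀ q → q ∈ S → F n q) →
    (∀ q → InQ S q ⇔ F n q) →
    (∀ q → (q ∈ S) ⇔ Harmonic n q) ⊎ (∀ q → (q ∈ S) ⇔ Uniform n q)
theorem3 n 1≤n S S⊆F QS⇔F with harmonic-or-dual 1≤n (fareyQuotients 1≤n S S⊆F QS⇔F)
... | inj₁ h = inj₁ (harmonic 1≤n S S⊆F QS⇔F h)
... | inj₂ u = inj₂ (uniform 1≤n S S⊆F QS⇔F u)
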